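{- Let $\alpha$ be a countable ordinal. For all $e,k\in\mathbb N$, all tuples $\vec a$ of natural numbers and all $b\in\mathbb N$, the set $$\{\vec f\in(\mathbb N^{\mathbb N})^k : \|\langle e,\vec a,\vec f,b\rangle\|_{\Omega_{\mathbf S}}<\alpha\}$$ is a Suslin set (a subset of $(\mathbb N^{\mathbb N})^k$).
   Context: The Suslin functional: $\mathbf S(g)=0$ if $\forall f\in\mathbb N^{\mathbb N}\exists n\,g(\bar f(n))=0$, and $1$ if $\exists f\forall n\,g(\bar f(n))>0$, $\bar f(n)=\langle f(0),\dots,f(n-1)\rangle$. $\Omega_{\mathbf S}$ is the set of tuples $\langle e,\vec a,\vec f,b\rangle$ with $\{e\}(\mathbf S,\vec a,\vec f)=b$ in the sense of Kleene computability (schemes S1–S9, arguments ordered as: $\mathbf S$, integers, functions), and $\|\cdot\|_{\Omega_{\mathbf S}}$ is the ordinal rank of the (well-founded) computation tree of the tuple; for tuples not in $\Omega_{\mathbf S}$ the condition $\|\cdot\|<\alpha$ is false. Suslin sets in $X=(\mathbb N^{\mathbb N})^k$: a Suslin scheme is $s\mapsto P_s\subseteq X$ on the set $\mathrm{SEQ}$ of finite sequences of naturals, $\mathbf A(\mathbf P)=\bigcup_f\bigcap_n P_{\bar f(n)}$; $\Sigma_0$ clopen sets; $\Sigma_\beta$ ($\beta>0$) sets $\mathbf A(\mathbf P)$ with each $P_s\in\Pi_\gamma$, some $\gamma<\beta$; $\Pi_\beta$ complements; Suslin sets $=\bigcup_{\beta<\omega_1}\Sigma_\beta$. -}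

module Defs where

open import Data.Fin using (Fin; zero; suc; toℕ)
open import Data.List using (List; []; _∷_; applyUpTo)
open import Data.Nat as ℕ using (ℕ; zero; suc; _*_; _^_)
open import Data.Product using (∃; _×_)
open import Data.Vec as Vec using (Vec; []; _∷_; lookup; removeAt; truncate)
open import Level using (0ℓ)
open import Relation.Binary.PropositionalEquality using (_≡_)
open import Relation.Unary using (Pred; ∁; _≐_)

-- Countable ordinals, given by Brouwer trees.  'lim f' is the supremum of an
-- arbitrary (not necessarily increasing) sequence, so every countable ordinal
-- is denoted by some tree; _≤_ and _<_ compare the ordinals denoted, and
-- distinct trees may denote the same ordinal.

data Ord : Set where
  zero : Ord
  suc  : Ord → Ord
  lim  : (ℕ → Ord) → Ord

infix 4 _≤_ _<_

data _≤_ : Ord → Ord → Set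
data _<_ : Ord → Ord → Set

data _≤_ where
  zero≤ : ∀ {β} → zero ≤ β
  suc≤  : ∀ {α β} → α < β → suc α ≤ β
  lim≤  : ∀ {f β} → (∀ n → f n ≤ β) → lim f ≤ β

data _<_ where
  <suc : ∀ {α β} → α ≤ β → α < suc β
  <lim : ∀ {α f} n → α < f n → α < lim f

infixl 6 _⊔_

_⊔_ : Ord → Ord → Ord
α ⊔ β = lim λ { zero → α ; (suc _) → β }

-- A bijective coding of finite sequences by natural numbers, based on the
-- fact that every positive number is uniquely of the form 2 ^ x * (2 y + 1).

⟨_⟩ : List ℕ → ℕ
⟨ [] ⟩     = 0
⟨ x ∷ xs ⟩ = 2 ^ x * suc (2 * ⟨ xs ⟩)

-- The graph of the Suslin functional; with excluded middle it is total.

data 𝐒_≃_ (g : ℕ → ℕ) : ℕ → Set where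
  𝐒≃0 : (∀ f → ∃ λ n → g ⟨ applyUpTo f n ⟩ ≡ 0) → 𝐒 g ≃ 0
  𝐒≃1 : (∃ λ f → ∀ n → g ⟨ applyUpTo f n ⟩ ℕ.> 0) → 𝐒 g ≃ 1

-- The number coding a signature: n₂ arguments of type 2, n₀ of type 0 and
-- n₁ of type 1.  As in Kleene's original indexing, every index records the
-- signature of the arguments it applies to.

sig : (n₂ n₀ n₁ : ℕ) → ℕ
sig n₂ n₀ n₁ = ⟨ n₀ ∷ n₁ ∷ n₂ ∷ [] ⟩

toFront : ∀ {A : Set} {n} → Fin n → Vec A n → Vec A n
toFront {n = suc _} i xs = lookup xs i ∷ removeAt xs i

-- 'Computation e n₂ as fs b' is the type of computation trees witnessing
-- {e}(𝐒, …, 𝐒, as, fs) = b, with n₂ occurrences of 𝐒.  Starting from n₂ = 1,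
-- the only change that can occur is that 𝐒 is dropped from the argument list
-- by S9, where {x} is applied to initial segments of the remaining arguments
-- of each type.  S6₀, S6₁ and S6₂ are the three instances of S6, moving to the
-- front an argument of type 0, 1 and 2 respectively; the last has no effect on
-- the arguments because all type-2 arguments are 𝐒.

data Computation : ℕ → (n₂ : ℕ) → ∀ {n₀ n₁} →
                   Vec ℕ n₀ → Vec (ℕ → ℕ) n₁ → ℕ → Set where

  S1 : ∀ {n₂ n₀ n₁ x} {as : Vec ℕ n₀} {fs : Vec (ℕ → ℕ) n₁} →
       Computation ⟨ 1 ∷ sig n₂ (suc n₀) n₁ ∷ [] ⟩ n₂ (x ∷ as) fs (suc x)

  S2 : ∀ {n₂ n₀ n₁ q} {as : Vec ℕ n₀} {fs : Vec (ℕ → ℕ) n₁} →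
       Computation ⟨ 2 ∷ sig n₂ n₀ n₁ ∷ q ∷ [] ⟩ n₂ as fs q

  S3 : ∀ {n₂ n₀ n₁ x} {as : Vec ℕ n₀} {fs : Vec (ℕ → ℕ) n₁} →
       Computation ⟨ 3 ∷ sig n₂ (suc n₀) n₁ ∷ [] ⟩ n₂ (x ∷ as) fs x

  S4 : ∀ {n₂ n₀ n₁ g h c b} {as : Vec ℕ n₀} {fs : Vec (ℕ → ℕ) n₁} →
       Computation h n₂ as fs c →
       Computation g n₂ (c ∷ as) fs b →
       Computation ⟨ 4 ∷ sig n₂ n₀ n₁ ∷ g ∷ h ∷ [] ⟩ n₂ as fs b

  S5-zero : ∀ {n₂ n₀ n₁ g h b} {as : Vec ℕ n₀} {fs : Vec (ℕ → ℕ) n₁} →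
       Computation g n₂ as fs b →
       Computation ⟨ 5 ∷ sig n₂ (suc n₀) n₁ ∷ g ∷ h ∷ [] ⟩ n₂ (0 ∷ as) fs b

  S5-suc : ∀ {n₂ n₀ n₁ g h x c b} {as : Vec ℕ n₀} {fs : Vec (ℕ → ℕ) n₁} →
       Computation ⟨ 5 ∷ sig n₂ (suc n₀) n₁ ∷ g ∷ h ∷ [] ⟩ n₂ (x ∷ as) fs c →
       Computation h n₂ (x ∷ c ∷ as) fs b →
       Computation ⟨ 5 ∷ sig n₂ (suc n₀) n₁ ∷ g ∷ h ∷ [] ⟩ n₂ (suc x ∷ as) fs b

  S6₀ : ∀ {n₂ n₀ n₁ g b} {as : Vec ℕ n₀} {fs : Vec (ℕ → ℕ) n₁} (i : Fin n₀) →
       Computation g n₂ (toFront i as) fs b →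
       Computation ⟨ 6 ∷ sig n₂ n₀ n₁ ∷ 0 ∷ toℕ i ∷ g ∷ [] ⟩ n₂ as fs b

  S6₁ : ∀ {n₂ n₀ n₁ g b} {as : Vec ℕ n₀} {fs : Vec (ℕ → ℕ) n₁} (i : Fin n₁) →
       Computation g n₂ as (toFront i fs) b →
       Computation ⟨ 6 ∷ sig n₂ n₀ n₁ ∷ 1 ∷ toℕ i ∷ g ∷ [] ⟩ n₂ as fs b

  S6₂ : ∀ {n₂ n₀ n₁ g b} {as : Vec ℕ n₀} {fs : Vec (ℕ → ℕ) n₁} (i : Fin n₂) →
       Computation g n₂ as fs b →
       Computation ⟨ 6 ∷ sig n₂ n₀ n₁ ∷ 2 ∷ toℕ i ∷ g ∷ [] ⟩ n₂ as fs b

  S7 : ∀ {n₂ n₀ n₁ x f} {as : Vec ℕ n₀} {fs : Vec (ℕ → ℕ) n₁} →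
       Computation ⟨ 7 ∷ sig n₂ (suc n₀) (suc n₁) ∷ [] ⟩ n₂ (x ∷ as) (f ∷ fs) (f x)

  S8 : ∀ {n₂ n₀ n₁ h b} {as : Vec ℕ n₀} {fs : Vec (ℕ → ℕ) n₁} (g : ℕ → ℕ) →
       (∀ n → Computation h (suc n₂) (n ∷ as) fs (g n)) →
       𝐒 g ≃ b →
       Computation ⟨ 8 ∷ sig (suc n₂) n₀ n₁ ∷ 2 ∷ h ∷ [] ⟩ (suc n₂) as fs b

  S9 : ∀ {n₂ n₀ n₁ m₂ m₀ m₁ x b} {as : Vec ℕ n₀} {fs : Vec (ℕ → ℕ) n₁} →
       m₂ ℕ.≤ n₂ → (m₀≤n₀ : m₀ ℕ.≤ n₀) (m₁≤n₁ : m₁ ℕ.≤ n₁) →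
       Computation x m₂ (truncate m₀≤n₀ as) (truncate m₁≤n₁ fs) b →
       Computation ⟨ 9 ∷ sig n₂ (suc n₀) n₁ ∷ sig m₂ m₀ m₁ ∷ [] ⟩ n₂ (x ∷ as) fs b

-- The rank of a tree is the supremum of rank + 1 over its immediate subtrees.

rank : ∀ {e n₂ n₀ n₁ b} {as : Vec ℕ n₀} {fs : Vec (ℕ → ℕ) n₁} →
       Computation e n₂ as fs b → Ord
rank S1             = zero
rank S2             = zero
rank S3             = zero
rank (S4 c d)       = suc (rank c) ⊔ suc (rank d)
rank (S5-zero c)    = suc (rank c)
rank (S5-suc c d)   = suc (rank c) ⊔ suc (rank d)
rank (S6₀ _ c)      = suc (rank c)
rank (S6₁ _ c)      = suc (rank c)
rank (S6₂ _ c)      = suc (rank c)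
rank S7             = zero
rank (S8 _ c _)     = lim λ n → suc (rank (c n))
rank (S9 _ _ _ c)   = suc (rank c)

-- Membership of ⟨ e , as , fs , b ⟩ in Ω_𝐒 with norm below α.  All computation
-- trees of a tuple have the same rank, as ordinals, since the intermediate
-- values are determined by the tuple; so the choice of c is immaterial.

‖_,_,_,_‖<_ : ∀ {l k} → ℕ → Vec ℕ l → Vec (ℕ → ℕ) k → ℕ → Ord → Set
‖ e , as , fs , b ‖< α = ∃ λ (c : Computation e 1 as fs b) → rank c < α

Space : ℕ → Set
Space k = Vec (ℕ → ℕ) k

-- Open and clopen sets for the product topology on Space k.

_≈[_]_ : ∀ {k} → Space k → ℕ → Space k → Set
fs ≈[ n ] gs = ∀ i x → x ℕ.< n → lookup fs i x ≡ lookup gs i x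

Open : ∀ {k} → Pred (Space k) 0ℓ → Set
Open U = ∀ fs → U fs → ∃ λ n → ∀ gs → fs ≈[ n ] gs → U gs

Clopen : ∀ {k} → Pred (Space k) 0ℓ → Set
Clopen U = Open U × Open (∁ U)

SuslinScheme : ℕ → Set₁
SuslinScheme k = List ℕ → Pred (Space k) 0ℓ

𝐀 : ∀ {k} → SuslinScheme k → Pred (Space k) 0ℓ
𝐀 P fs = ∃ λ (f : ℕ → ℕ) → ∀ n → P (applyUpTo f n) fs

data 𝚺 {k} : Ord → Pred (Space k) 0ℓ → Set₁
data 𝚷 {k} : Ord → Pred (Space k) 0ℓ → Set₁

data 𝚺 {k} where
  clopen : ∀ {β X} → β ≤ zero → Clopen X → 𝚺 β X
  suslin : ∀ {β X} → zero < β → (P : SuslinScheme k) →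
           (∀ s → ∃ λ γ → γ < β × 𝚷 γ (P s)) →
           X ≐ 𝐀 P → 𝚺 β X

data 𝚷 {k} where
  complement : ∀ {β X Y} → 𝚺 β Y → X ≐ ∁ Y → 𝚷 β X

IsSuslin : ∀ {k} → Pred (Space k) 0ℓ → Set₁
IsSuslin X = ∃ λ β → 𝚺 β X

{-# OPTIONS --safe #-}
module Submission where

-- By recursion on α, simultaneously for all signatures.  A rank is < lim f iff
-- it is < f n for some n, and a tree has rank < suc β iff all its immediate
-- subtrees have rank < β.  So the set for suc β arises from sets for β by
-- countable unions and intersections, projections of coordinates and, for S8,
-- the Suslin operation and its dual; Suslin sets are closed under all of these.

open import Defs
open import Axiom.ExcludedMiddle using (ExcludedMiddle)
open import Data.Empty using (⊥)
open import Data.Fin using (Fin; zero; suc; toℕ; inject≤)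
open import Data.Fin.Properties using (toℕ-injective)
open import Data.List using (List; []; _∷_; applyUpTo; length)
open import Data.List.Properties using (length-applyUpTo)
open import Data.Nat as ℕ using (ℕ; zero; suc)
open import Data.Nat.Properties using (n<1+n; ≤-irrelevant)
open import Data.Product using (∃; _×_; _,_; proj₁; proj₂; map₂)
open import Data.Vec using (Vec; []; _∷_; lookup; removeAt; truncate)
open import Data.Vec.Properties using (lookup-truncate)
open import Function using (_∘_; id; const)
open import Function.Definitions using (Injective)
open import Level using (0ℓ)
open import Relation.Binary.PropositionalEquality
open import Relation.Nullary using (yes; no; contradiction)
open import Relation.Nullary.Decidable using (decidable-stable)
open import Relation.Unary using (Pred; ∁; _≐_; _⊆_; ∅; U; _∩_; ⋃; ⋂)
open import Relation.Unary.Properties using (≐-sym; ≐-trans)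

private
  variable
    k m n₀ n₁ : ℕ
    X Y : Pred (Space k) 0ℓ
    I : Set

-- Order and suprema of countable ordinals.

≤-lim : ∀ {α f} n → α ≤ f n → α ≤ lim f
≤-lim n zero≤    = zero≤
≤-lim n (suc≤ p) = suc≤ (<lim n p)
≤-lim n (lim≤ p) = lim≤ λ i → ≤-lim n (p i)

≤-refl : ∀ {α} → α ≤ α
≤-refl {zero}  = zero≤
≤-refl {suc _} = suc≤ (<suc ≤-refl)
≤-refl {lim _} = lim≤ λ n → ≤-lim n ≤-refl

-- `lim` takes only `ℕ`-indexed families, so a supremum over all finite sequences is split by
-- length, with one nested limit per entry.
sup-length : ℕ → (List ℕ → Ord) → Ord
sup-length zero    F = F []
sup-length (suc n) F = lim λ x → sup-length n (F ∘ (x ∷_))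

sup : (List ℕ → Ord) → Ord
sup F = lim λ n → sup-length n F

<-sup : ∀ {γ} F s → γ < F s → γ < sup F
<-sup F s p = <lim (length s) (go F s p)
  where
  go : ∀ {γ} F s → γ < F s → γ < sup-length (length s) F
  go F []      p = p
  go F (x ∷ s) p = <lim x (go (F ∘ (x ∷_)) s p)

-- Extensionality, clopen sets and complements.

∁-cong : X ≐ Y → ∁ X ≐ ∁ Y
∁-cong (X⊆Y , Y⊆X) = (_∘ Y⊆X) , (_∘ X⊆Y)

Open-resp : X ≐ Y → Open X → Open Y
Open-resp (X⊆Y , Y⊆X) open-X fs y with open-X fs (Y⊆X y)
... | n , near = n , λ gs fs≈gs → X⊆Y (near gs fs≈gs)

IsSuslin-resp : X ≐ Y → IsSuslin X → IsSuslin Y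
IsSuslin-resp X≐Y (β , clopen β≤0 (o , o′)) =
  β , clopen β≤0 (Open-resp X≐Y o , Open-resp (∁-cong X≐Y) o′)
IsSuslin-resp X≐Y (β , suslin 0<β P π X≐𝐀P) =
  β , suslin 0<β P π (≐-trans (≐-sym X≐Y) X≐𝐀P)

clopen-suslin : Clopen X → IsSuslin X
clopen-suslin c = zero , clopen zero≤ c

const-suslin : (A : Set) → IsSuslin {k} (λ _ → A)
const-suslin A = clopen-suslin ((λ _ a → 0 , λ _ _ → a) , (λ _ ¬a → 0 , λ _ _ → ¬a))

-- `∁ X` is `𝚷 β`, and 𝐀 of a constant scheme is its constant value, so `∁ X` is `𝚺` one level
-- higher.
∁-suslin : IsSuslin X → IsSuslin (∁ X)
∁-suslin {X = X} (β , σ) = suc β ,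
  suslin (<suc zero≤) (λ _ → ∁ X) (λ _ → β , <suc ≤-refl , complement σ (id , id))
    ((λ ¬x → const 0 , const ¬x) , (λ (_ , h) → h 0))

-- Preimages under rearrangement and truncation of coordinates.

Nonexpansive : (Space k → Space m) → Set
Nonexpansive φ = ∀ n {fs gs} → fs ≈[ n ] gs → φ fs ≈[ n ] φ gs

module _ {φ : Space k → Space m} (φ-cont : Nonexpansive φ) where

  Open-preimage : Open X → Open (X ∘ φ)
  Open-preimage o fs x with o (φ fs) x
  ... | n , near = n , λ gs fs≈gs → near (φ gs) (φ-cont n fs≈gs)

  -- Preimages commute with 𝐀 and with complements, so the level is kept and continuity matters only
  -- for the clopen sets at the bottom.
  𝚺-preimage : ∀ {β} → 𝚺 β X → 𝚺 β (X ∘ φ)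
  𝚷-preimage : ∀ {β} → 𝚷 β X → 𝚷 β (X ∘ φ)

  𝚺-preimage (clopen β≤0 (o , o′)) = clopen β≤0 (Open-preimage o , Open-preimage o′)
  𝚺-preimage (suslin 0<β P π (X⊆ , ⊆X)) = suslin 0<β (λ s → P s ∘ φ) π′ (X⊆ , ⊆X)
    where
    π′ : ∀ s → _
    π′ s with π s
    ... | γ , γ<β , p = γ , γ<β , 𝚷-preimage p
  𝚷-preimage (complement σ (X⊆ , ⊆X)) = complement (𝚺-preimage σ) (X⊆ , ⊆X)

  preimage-suslin : IsSuslin X → IsSuslin (X ∘ φ)
  preimage-suslin (β , σ) = β , 𝚺-preimage σ

removeAt-nonexpansive : (i : Fin (suc k)) → Nonexpansive (λ fs → removeAt fs i)
removeAt-nonexpansive zero n {_ ∷ _} {_ ∷ _} fs≈gs j = fs≈gs (suc j)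
removeAt-nonexpansive (suc i) n {_ ∷ _ ∷ _} {_ ∷ _ ∷ _} fs≈gs zero = fs≈gs zero
removeAt-nonexpansive (suc i) n {_ ∷ fs@(_ ∷ _)} {_ ∷ gs@(_ ∷ _)} fs≈gs (suc j) =
  removeAt-nonexpansive i n {fs} {gs} (fs≈gs ∘ suc) j

toFront-nonexpansive : (i : Fin k) → Nonexpansive (toFront i)
toFront-nonexpansive {suc _} i n fs≈gs zero = fs≈gs i
toFront-nonexpansive {suc _} i n {fs} {gs} fs≈gs (suc j) =
  removeAt-nonexpansive i n {fs} {gs} fs≈gs j

truncate-nonexpansive : (m≤k : m ℕ.≤ k) → Nonexpansive (truncate m≤k)
truncate-nonexpansive m≤k n {fs} {gs} fs≈gs i x x<n
  rewrite lookup-truncate m≤k fs i | lookup-truncate m≤k gs i = fs≈gs (inject≤ i m≤k) x x<n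

-- One-step unfolding of computations, scheme by scheme.

HeadValue : ℕ → ℕ → Pred (Space k) 0ℓ
HeadValue x b []      = ⊥
HeadValue x b (f ∷ _) = f x ≡ b

HeadValue-suslin : ∀ {k} x b → IsSuslin (HeadValue {k} x b)
HeadValue-suslin {zero}  x b = IsSuslin-resp ((λ ()) , λ { {[]} () }) (const-suslin ⊥)
HeadValue-suslin {suc k} x b = clopen-suslin (near , near′)
  where
  near : Open (HeadValue x b)
  -- Agreement below `suc x` includes position `x`, the only one on which the condition depends.
  near (_ ∷ _) fx≡b = suc x , λ { (_ ∷ _) fs≈gs → trans (sym (fs≈gs zero x (n<1+n x))) fx≡b }
  near′ : Open (∁ (HeadValue x b))
  near′ (_ ∷ _) fx≢b =
    suc x , λ { (_ ∷ _) fs≈gs gx≡b → fx≢b (trans (fs≈gs zero x (n<1+n x)) gx≡b) }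

-- The shape of S8: `Y n v` is the set where the `n`-th premise can take the value `v`.
SuslinValue : (ℕ → ℕ → Pred (Space k) 0ℓ) → ℕ → Pred (Space k) 0ℓ
SuslinValue Y b fs = ∃ λ g → (∀ n → Y n (g n) fs) × 𝐒 g ≃ b

Converges : Ord → ℕ → ℕ → Vec ℕ n₀ → ℕ → Pred (Space n₁) 0ℓ
Converges α e n₂ as b fs = ∃ λ (c : Computation e n₂ as fs b) → rank c < α

-- Several schemes require a first numerical argument; `a` is the default when there is none.
uncons : ∀ {A : Set₁} → A → (∀ {n} → ℕ → Vec ℕ n → A) → Vec ℕ n₀ → A
uncons a f []       = a
uncons a f (x ∷ xs) = f x xs

-- 'Premises s β e n₂ as b' is the set of fs for which ⟨ e , as , fs , b ⟩ is
-- the conclusion of an instance of scheme s whose premises have rank below β.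
-- 'Permuted j' is S6 for arguments of type j.

Permuted : ℕ → Ord → ℕ → ℕ → Vec ℕ n₀ → ℕ → Pred (Space n₁) 0ℓ
Permuted {n₀} {n₁} 0 β e n₂ as b = ⋃ (Fin n₀) λ i → ⋃ ℕ λ g →
  (λ _ → e ≡ ⟨ 6 ∷ sig n₂ n₀ n₁ ∷ 0 ∷ toℕ i ∷ g ∷ [] ⟩) ∩ Converges β g n₂ (toFront i as) b
Permuted {n₀} {n₁} 1 β e n₂ as b = ⋃ (Fin n₁) λ i → ⋃ ℕ λ g →
  (λ _ → e ≡ ⟨ 6 ∷ sig n₂ n₀ n₁ ∷ 1 ∷ toℕ i ∷ g ∷ [] ⟩) ∩ (Converges β g n₂ as b ∘ toFront i)
Permuted {n₀} {n₁} 2 β e n₂ as b = ⋃ (Fin n₂) λ i → ⋃ ℕ λ g →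
  (λ _ → e ≡ ⟨ 6 ∷ sig n₂ n₀ n₁ ∷ 2 ∷ toℕ i ∷ g ∷ [] ⟩) ∩ Converges β g n₂ as b
Permuted _ β e n₂ as b = ∅

Recursion : Ord → ℕ → ℕ → ℕ → Vec ℕ n₀ → ℕ → Pred (Space n₁) 0ℓ
Recursion {n₀} {n₁} β e n₂ zero as b = ⋃ ℕ λ g → ⋃ ℕ λ h →
  (λ _ → e ≡ ⟨ 5 ∷ sig n₂ (suc n₀) n₁ ∷ g ∷ h ∷ [] ⟩) ∩ Converges β g n₂ as b
Recursion {n₀} {n₁} β e n₂ (suc x) as b = ⋃ ℕ λ g → ⋃ ℕ λ h → ⋃ ℕ λ c →
  (λ _ → e ≡ ⟨ 5 ∷ sig n₂ (suc n₀) n₁ ∷ g ∷ h ∷ [] ⟩) ∩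
  (Converges β e n₂ (x ∷ as) c ∩ Converges β h n₂ (x ∷ c ∷ as) b)

Premises : ℕ → Ord → ℕ → ℕ → Vec ℕ n₀ → ℕ → Pred (Space n₁) 0ℓ
Premises {n₁ = n₁} 1 β e n₂ as b = uncons ∅ (λ {n₀} x _ _ →
  e ≡ ⟨ 1 ∷ sig n₂ (suc n₀) n₁ ∷ [] ⟩ × b ≡ suc x) as
Premises {n₀} {n₁} 2 β e n₂ as b _ =
  e ≡ ⟨ 2 ∷ sig n₂ n₀ n₁ ∷ b ∷ [] ⟩
Premises {n₁ = n₁} 3 β e n₂ as b = uncons ∅ (λ {n₀} x _ _ →
  e ≡ ⟨ 3 ∷ sig n₂ (suc n₀) n₁ ∷ [] ⟩ × b ≡ x) as
Premises {n₀} {n₁} 4 β e n₂ as b = ⋃ ℕ λ g → ⋃ ℕ λ h → ⋃ ℕ λ c →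
  (λ _ → e ≡ ⟨ 4 ∷ sig n₂ n₀ n₁ ∷ g ∷ h ∷ [] ⟩) ∩
  (Converges β h n₂ as c ∩ Converges β g n₂ (c ∷ as) b)
Premises 5 β e n₂ as b = uncons ∅ (λ x as → Recursion β e n₂ x as b) as
Premises 6 β e n₂ as b = ⋃ ℕ λ j → Permuted j β e n₂ as b
Premises {n₁ = n₁} 7 β e n₂ as b = uncons ∅ (λ {n₀} x _ →
  (λ _ → e ≡ ⟨ 7 ∷ sig n₂ (suc n₀) n₁ ∷ [] ⟩) ∩ HeadValue x b) as
Premises 8 β e zero as b = ∅
Premises {n₀} {n₁} 8 β e (suc n₂) as b = ⋃ ℕ λ h →
  (λ _ → e ≡ ⟨ 8 ∷ sig (suc n₂) n₀ n₁ ∷ 2 ∷ h ∷ [] ⟩) ∩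
  SuslinValue (λ n v → Converges β h (suc n₂) (n ∷ as) v) b
Premises {n₁ = n₁} 9 β e n₂ as b = uncons ∅ (λ {n₀} x as →
  ⋃ ℕ λ m₂ → ⋃ ℕ λ m₀ → ⋃ ℕ λ m₁ →
  ⋃ (m₀ ℕ.≤ n₀) λ m₀≤n₀ → ⋃ (m₁ ℕ.≤ n₁) λ m₁≤n₁ →
  (λ _ → m₂ ℕ.≤ n₂ × e ≡ ⟨ 9 ∷ sig n₂ (suc n₀) n₁ ∷ sig m₂ m₀ m₁ ∷ [] ⟩) ∩
  (Converges β x m₂ (truncate m₀≤n₀ as) b ∘ truncate m₁≤n₁)) as
Premises _ β e n₂ as b = ∅

-- Inversion of the last scheme: rank `< suc β` means rank `≤ β`, and the rank is a supremum of
-- successors of the ranks of the subtrees, so each of these is `< β`.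
premises : ∀ {β e n₂ b} {as : Vec ℕ n₀} →
           Converges {n₁ = n₁} (suc β) e n₂ as b ⊆ ⋃ ℕ λ s → Premises s β e n₂ as b
premises (S1 , _) = 1 , refl , refl
premises (S2 , _) = 2 , refl
premises (S3 , _) = 3 , refl , refl
-- `⊔` is a limit whose index 0 holds the left ordinal and index 1 the right one.
premises (S4 {g = g} {h = h} {c = v} c d , <suc (lim≤ p)) with p 0 | p 1
... | suc≤ q | suc≤ r = 4 , g , h , v , refl , (c , q) , (d , r)
premises (S5-zero {g = g} {h = h} c , <suc (suc≤ p)) = 5 , g , h , refl , c , p
premises (S5-suc {g = g} {h = h} {c = v} c d , <suc (lim≤ p)) with p 0 | p 1
... | suc≤ q | suc≤ r = 5 , g , h , v , refl , (c , q) , (d , r)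
premises (S6₀ {g = g} i c , <suc (suc≤ p)) = 6 , 0 , i , g , refl , c , p
premises (S6₁ {g = g} i c , <suc (suc≤ p)) = 6 , 1 , i , g , refl , c , p
premises (S6₂ {g = g} i c , <suc (suc≤ p)) = 6 , 2 , i , g , refl , c , p
premises (S7 , _) = 7 , refl , refl
premises (S8 {h = h} g c v , <suc (lim≤ p)) = 8 , h , refl , g , (λ n → c n , suc≤⁻ (p n)) , v
  where
  suc≤⁻ : ∀ {α β} → suc α ≤ β → α < β
  suc≤⁻ (suc≤ q) = q
premises (S9 {m₂ = m₂} {m₀ = m₀} {m₁ = m₁} p₂ p₀ p₁ c , <suc (suc≤ p)) =
  9 , m₂ , m₀ , m₁ , p₀ , p₁ , (p₂ , refl) , c , p

⊔-≤ : ∀ {α β γ} → α ≤ γ → β ≤ γ → α ⊔ β ≤ γ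
⊔-≤ p q = lim≤ λ { zero → p ; (suc _) → q }

-- The implicit arguments are given to keep the unifier from normalising codes.

conclusion : ∀ {n₀ n₁ β e n₂ b} (as : Vec ℕ n₀) s →
             Premises {n₁ = n₁} s β e n₂ as b ⊆ Converges (suc β) e n₂ as b
conclusion {n₁ = n₁} {n₂ = n₂} (_∷_ {n₀} x as) 1 (refl , refl) =
  S1 {n₂} {n₀} {n₁} , <suc zero≤
conclusion {n₀} {n₁} {n₂ = n₂} as 2 refl = S2 {n₂} {n₀} {n₁} , <suc zero≤
conclusion {n₁ = n₁} {n₂ = n₂} (_∷_ {n₀} x as) 3 (refl , refl) =
  S3 {n₂} {n₀} {n₁} , <suc zero≤
conclusion {n₀} {n₁} {n₂ = n₂} as 4 (g , h , v , refl , (c , p) , (d , q)) =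
  S4 {n₂} {n₀} {n₁} {g} {h} c d , <suc (⊔-≤ (suc≤ p) (suc≤ q))
conclusion {n₁ = n₁} {n₂ = n₂} (_∷_ {n₀} zero as) 5 (g , h , refl , c , p) =
  S5-zero {n₂} {n₀} {n₁} {g} {h} c , <suc (suc≤ p)
conclusion {n₁ = n₁} {n₂ = n₂} (_∷_ {n₀} (suc x) as) 5 (g , h , v , refl , (c , p) , (d , q)) =
  S5-suc {n₂} {n₀} {n₁} {g} {h} c d , <suc (⊔-≤ (suc≤ p) (suc≤ q))
conclusion {n₀} {n₁} {n₂ = n₂} as 6 (0 , i , g , refl , c , p) =
  S6₀ {n₂} {n₀} {n₁} {g} i c , <suc (suc≤ p)
conclusion {n₀} {n₁} {n₂ = n₂} as 6 (1 , i , g , refl , c , p) =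
  S6₁ {n₂} {n₀} {n₁} {g} i c , <suc (suc≤ p)
conclusion {n₀} {n₁} {n₂ = n₂} as 6 (2 , i , g , refl , c , p) =
  S6₂ {n₂} {n₀} {n₁} {g} i c , <suc (suc≤ p)
conclusion {n₂ = n₂} (_∷_ {n₀} x as) 7 {_∷_ {n₁} f fs} (refl , refl) =
  S7 {n₂} {n₀} {n₁} {x} {f} {as} {fs} , <suc zero≤
conclusion {n₂ = zero} as 8 ()
conclusion {n₀} {n₁} {n₂ = suc n₂} as 8 (h , refl , g , c , v) =
  S8 {n₂} {n₀} {n₁} {h} g (proj₁ ∘ c) v , <suc (lim≤ (suc≤ ∘ proj₂ ∘ c))
conclusion [] 9 ()
conclusion {n₁ = n₁} {n₂ = n₂} (_∷_ {n₀} x as) 9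
           (m₂ , m₀ , m₁ , p₀ , p₁ , (p₂ , refl) , c , p) =
  S9 {n₂} {n₀} {n₁} {m₂} {m₀} {m₁} p₂ p₀ p₁ c , <suc (suc≤ p)

-- Closure under 𝐀, countable unions and intersections, and the functional 𝐒.

module _ (em : ExcludedMiddle 0ℓ) where

  -- A scheme must consist of `𝚷` sets. By excluded middle each `P s` is the complement of its
  -- complement, which is Suslin.
  𝐀-suslin : {P : SuslinScheme k} → (∀ s → IsSuslin (P s)) → IsSuslin (𝐀 P)
  𝐀-suslin {P = P} σ = sup bound , suslin (<-sup bound [] (<suc zero≤)) P π (id , id)
    where
    bound : List ℕ → Ord
    -- One successor comes from `∁-suslin`, the other makes the bound strict.
    bound s = suc (suc (proj₁ (σ s)))
    π : ∀ s → ∃ λ γ → γ < sup bound × 𝚷 γ (P s)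
    π s = let γ , ∁-σ = ∁-suslin (σ s) in
      γ , <-sup bound s (<suc ≤-refl) ,
      complement ∁-σ ((λ x ¬x → ¬x x) , decidable-stable em)

  -- If the scheme depends only on the length of `s`, every branch yields the whole intersection.
  ⋂-suslin : {X : ℕ → Pred (Space k) 0ℓ} → (∀ n → IsSuslin (X n)) → IsSuslin (⋂ ℕ X)
  ⋂-suslin {X = X} σ = IsSuslin-resp
    ( (λ {fs} (f , h) n → subst (λ i → X i fs) (length-applyUpTo f n) (h n))
    , (λ h → id , λ n → h (length (applyUpTo id n))) )
    (𝐀-suslin (σ ∘ length))

  -- The first entry of a branch selects the index. Below an entry `n` the scheme is a single `X i`,
  -- by injectivity, or empty if `n` codes nothing.
  ⋃-suslin : (code : I → ℕ) → Injective _≡_ _≡_ code → {X : I → Pred (Space k) 0ℓ} →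
             (∀ i → IsSuslin (X i)) → IsSuslin (⋃ I X)
  ⋃-suslin {I} {k} code code-injective {X} σ = IsSuslin-resp
    -- The segment of length 1 is the first to contain an entry.
    ( (λ (f , h) → map₂ proj₂ (h 1))
    , (λ (i , x) → const (code i) , λ { zero → _ ; (suc _) → i , refl , x }) )
    (𝐀-suslin σ′)
    where
    P : SuslinScheme k
    P []      = U
    P (n ∷ _) = ⋃ I λ i → (λ _ → code i ≡ n) ∩ X i
    σ′ : ∀ s → IsSuslin (P s)
    σ′ []      = const-suslin _
    σ′ (n ∷ _) with em {∃ λ i → code i ≡ n}
    ... | no  none       = IsSuslin-resp ((λ ()) , λ (i , eq , _) → none (i , eq)) (const-suslin ⊥)
    ... | yes (i , refl) = IsSuslin-resp
      ( (λ x → i , refl , x)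
      , (λ {fs} (j , eq , x) → subst (λ i → X i fs) (code-injective eq) x) ) (σ i)

  ⋃ℕ-suslin : {X : ℕ → Pred (Space k) 0ℓ} → (∀ n → IsSuslin (X n)) → IsSuslin (⋃ ℕ X)
  ⋃ℕ-suslin = ⋃-suslin id id

  ⋃Fin-suslin : {X : Fin m → Pred (Space k) 0ℓ} → (∀ i → IsSuslin (X i)) → IsSuslin (⋃ (Fin m) X)
  ⋃Fin-suslin = ⋃-suslin toℕ toℕ-injective

  -- Proofs of `i ≤ j` are unique, so a constant code is injective. Such unions come from the
  -- truncations in S9.
  ⋃≤-suslin : ∀ {i j} {X : i ℕ.≤ j → Pred (Space k) 0ℓ} →
              (∀ p → IsSuslin (X p)) → IsSuslin (⋃ (i ℕ.≤ j) X)
  ⋃≤-suslin = ⋃-suslin (const 0) (λ _ → ≤-irrelevant _ _)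

  ∩-suslin : IsSuslin X → IsSuslin Y → IsSuslin (X ∩ Y)
  ∩-suslin {X = X} {Y} σ τ = IsSuslin-resp
    ( (λ h → h 0 , h 1) , (λ { (x , y) zero → x ; (x , y) (suc _) → y }) )
    (⋂-suslin {X = λ { zero → X ; (suc _) → Y }} λ { zero → σ ; (suc _) → τ })

  if-suslin : {A : Set} → IsSuslin X → IsSuslin ((λ _ → A) ∩ X)
  if-suslin = ∩-suslin (const-suslin _)

  module _ {Y : ℕ → ℕ → Pred (Space k) 0ℓ} where

    -- Choosing a value in Q whenever there is one makes it unnecessary to know
    -- that values are unique.

    prefer : (Q : Pred ℕ 0ℓ) → ∀ {n fs} → ∃ (λ v → Y n v fs) →
             ∃ λ v → Y n v fs × (∃ (λ w → Q w × Y n w fs) → Q v)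
    prefer Q {n} {fs} (v , y) with em {∃ λ w → Q w × Y n w fs}
    ... | yes (w , q , y′) = w , y′ , const q
    ... | no  none         = v , y , λ some → contradiction some none

    -- Every premise must have a value. In addition, 𝐒 is 1 if some branch admits positive values
    -- throughout, an instance of 𝐀, and 0 if no branch avoids the value 0 throughout, the
    -- complement of an instance of 𝐀.
    SuslinValue-suslin : (∀ n v → IsSuslin (Y n v)) → ∀ b → IsSuslin (SuslinValue Y b)
    SuslinValue-suslin σ 0 = IsSuslin-resp (to , from)
      (∩-suslin (⋂-suslin λ n → ⋃ℕ-suslin (σ n)) (∁-suslin (𝐀-suslin λ s → ∁-suslin (σ ⟨ s ⟩ 0))))
      where
      to : ⋂ ℕ (λ n → ⋃ ℕ (Y n)) ∩ ∁ (𝐀 (λ s → ∁ (Y ⟨ s ⟩ 0))) ⊆ SuslinValue Y 0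
      to {fs} (total , bar) = proj₁ ∘ g , proj₁ ∘ proj₂ ∘ g ,
        -- If `g` never vanished along `f`, its preference for 0 would make `f` avoid the value 0,
        -- contradicting `bar`.
        𝐒≃0 λ f → decidable-stable em λ never →
          bar (f , λ n y → never (n , proj₂ (proj₂ (g ⟨ applyUpTo f n ⟩)) (0 , refl , y)))
        where
        g : ∀ n → _
        g n = prefer (_≡ 0) {n} {fs} (total n)
      from : SuslinValue Y 0 ⊆ ⋂ ℕ (λ n → ⋃ ℕ (Y n)) ∩ ∁ (𝐀 (λ s → ∁ (Y ⟨ s ⟩ 0)))
      from {fs} (g , y , 𝐒≃0 bar) = (λ n → g n , y n) ,
        λ (f , h) → let n , eq = bar f in
          h n (subst (λ v → Y ⟨ applyUpTo f n ⟩ v fs) eq (y ⟨ applyUpTo f n ⟩))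
    SuslinValue-suslin σ 1 = IsSuslin-resp (to , from)
      (∩-suslin (⋂-suslin λ n → ⋃ℕ-suslin (σ n))
                (𝐀-suslin λ s → ⋃ℕ-suslin λ v → if-suslin (σ ⟨ s ⟩ v)))
      where
      Positive : SuslinScheme k
      Positive s = ⋃ ℕ λ v → (λ _ → v ℕ.> 0) ∩ Y ⟨ s ⟩ v
      to : ⋂ ℕ (λ n → ⋃ ℕ (Y n)) ∩ 𝐀 Positive ⊆ SuslinValue Y 1
      to {fs} (total , f , h) = proj₁ ∘ g , proj₁ ∘ proj₂ ∘ g ,
        𝐒≃1 (f , λ n → proj₂ (proj₂ (g ⟨ applyUpTo f n ⟩)) (h n))
        where
        g : ∀ n → _
        g n = prefer (ℕ._> 0) {n} {fs} (total n)
      from : SuslinValue Y 1 ⊆ ⋂ ℕ (λ n → ⋃ ℕ (Y n)) ∩ 𝐀 Positive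
      from (g , y , 𝐒≃1 (f , pos)) = (λ n → g n , y n) ,
        f , λ n → g ⟨ applyUpTo f n ⟩ , pos n , y ⟨ applyUpTo f n ⟩
    SuslinValue-suslin σ (suc (suc _)) =
      IsSuslin-resp ((λ ()) , λ { (_ , _ , ()) }) (const-suslin ⊥)

  -- Induction on the bound for the rank.

  uncons-suslin : {f : ∀ {n} → ℕ → Vec ℕ n → Pred (Space k) 0ℓ} →
                  (∀ {n} x (as : Vec ℕ n) → IsSuslin (f x as)) →
                  (as : Vec ℕ n₀) → IsSuslin (uncons ∅ f as)
  uncons-suslin σ []       = const-suslin ⊥
  uncons-suslin σ (x ∷ as) = σ x as

  module _ {β : Ord}
    -- The signature varies because S4, S5 and S8 change the length of `as`, while S9 may shorten
    -- all the argument lists.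
    (IH : ∀ {n₀ n₁} e n₂ (as : Vec ℕ n₀) b → IsSuslin {n₁} (Converges β e n₂ as b))
    where

    Permuted-suslin : ∀ j e n₂ (as : Vec ℕ n₀) b → IsSuslin {n₁} (Permuted j β e n₂ as b)
    Permuted-suslin 0 e n₂ as b = ⋃Fin-suslin λ i → ⋃ℕ-suslin λ g →
      if-suslin (IH g n₂ (toFront i as) b)
    Permuted-suslin 1 e n₂ as b = ⋃Fin-suslin λ i → ⋃ℕ-suslin λ g →
      if-suslin (preimage-suslin (toFront-nonexpansive i) (IH g n₂ as b))
    Permuted-suslin 2 e n₂ as b = ⋃Fin-suslin λ i → ⋃ℕ-suslin λ g →
      if-suslin (IH g n₂ as b)
    Permuted-suslin (suc (suc (suc _))) e n₂ as b = const-suslin ⊥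

    Recursion-suslin : ∀ e n₂ x (as : Vec ℕ n₀) b → IsSuslin {n₁} (Recursion β e n₂ x as b)
    Recursion-suslin e n₂ zero as b = ⋃ℕ-suslin λ g → ⋃ℕ-suslin λ h →
      if-suslin (IH g n₂ as b)
    Recursion-suslin e n₂ (suc x) as b = ⋃ℕ-suslin λ g → ⋃ℕ-suslin λ h → ⋃ℕ-suslin λ c →
      -- The premise at `x` has the same index `e` but rank below `β`, so the induction on rank
      -- covers it.
      if-suslin (∩-suslin (IH e n₂ (x ∷ as) c) (IH h n₂ (x ∷ c ∷ as) b))

    Premises-suslin : ∀ s e n₂ (as : Vec ℕ n₀) b → IsSuslin {n₁} (Premises s β e n₂ as b)
    Premises-suslin 0 e n₂ as b = const-suslin ⊥
    Premises-suslin 1 e n₂ as b = uncons-suslin (λ _ _ → const-suslin _) as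
    Premises-suslin 2 e n₂ as b = const-suslin _
    Premises-suslin 3 e n₂ as b = uncons-suslin (λ _ _ → const-suslin _) as
    Premises-suslin 4 e n₂ as b = ⋃ℕ-suslin λ g → ⋃ℕ-suslin λ h → ⋃ℕ-suslin λ c →
      if-suslin (∩-suslin (IH h n₂ as c) (IH g n₂ (c ∷ as) b))
    Premises-suslin 5 e n₂ as b = uncons-suslin (λ x as → Recursion-suslin e n₂ x as b) as
    Premises-suslin 6 e n₂ as b = ⋃ℕ-suslin λ j → Permuted-suslin j e n₂ as b
    Premises-suslin 7 e n₂ as b = uncons-suslin (λ x _ → if-suslin (HeadValue-suslin x b)) as
    Premises-suslin 8 e zero as b = const-suslin ⊥
    Premises-suslin 8 e (suc n₂) as b = ⋃ℕ-suslin λ h →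
      if-suslin (SuslinValue-suslin (λ n v → IH h (suc n₂) (n ∷ as) v) b)
    Premises-suslin 9 e n₂ as b = uncons-suslin (λ x as →
      ⋃ℕ-suslin λ m₂ → ⋃ℕ-suslin λ m₀ → ⋃ℕ-suslin λ m₁ →
      ⋃≤-suslin λ m₀≤n₀ → ⋃≤-suslin λ m₁≤n₁ →
      if-suslin (preimage-suslin (truncate-nonexpansive m₁≤n₁)
                                 (IH x m₂ (truncate m₀≤n₀ as) b))) as
    Premises-suslin (suc (suc (suc (suc (suc (suc (suc (suc (suc (suc _)))))))))) e n₂ as b =
      const-suslin ⊥

  Converges-suslin : ∀ α e n₂ (as : Vec ℕ n₀) b → IsSuslin {n₁} (Converges α e n₂ as b)
  Converges-suslin zero e n₂ as b = IsSuslin-resp ((λ ()) , λ { (_ , ()) }) (const-suslin ⊥)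
  Converges-suslin (suc β) e n₂ as b = IsSuslin-resp
    ((λ (s , p) → conclusion as s p) , premises)
    (⋃ℕ-suslin λ s → Premises-suslin (Converges-suslin β) s e n₂ as b)
  Converges-suslin (lim f) e n₂ as b = IsSuslin-resp
    ( (λ (n , c , p) → c , <lim n p) , (λ { (c , <lim n p) → n , c , p }) )
    (⋃ℕ-suslin λ n → Converges-suslin (f n) e n₂ as b)

theorem3p2 : ExcludedMiddle 0ℓ →
    (α : Ord) (e k l : ℕ) (as : Vec ℕ l) (b : ℕ) →
    IsSuslin {k} (λ fs → ‖ e , as , fs , b ‖< α)
-- The case of one occurrence of 𝐒; other values of `n₂` serve the subcomputations of S9.
theorem3p2 em α e k l as b = Converges-suslin em α e 1 as b
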